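{- The class of i-models has a minimal model: there exists an i-web $\mathbf{B}$ such that $\mathrm{Eq}(\mathbf{B}^+)$ is exactly the set of equations satisfied in all i-models, i.e. for all closed $\lambda$-terms $M,N$, the equation $M=N$ holds in $\mathbf{B}^+$ if and only if it holds in $\mathbf{A}^+$ for every i-web $\mathbf{A}$.
   Context: $\mathcal{P}_{\mathrm f}(A)$ is the set of finite subsets of $A$, and $\subseteq_{\mathrm f}$ means "is a finite subset of". An information system is a tuple $\mathcal{A}=(A,\mathrm{Con}_A,\vdash_A,\nu_A)$ where $A$ is a set (of tokens), $\nu_A\in A$, $\mathrm{Con}_A\subseteq\mathcal{P}_{\mathrm f}(A)$ is downward closed (under inclusion) and contains all singletons, and $\vdash_A\subseteq\mathrm{Con}_A\times A$ satisfies, writing $a\vdash_A b$ for "$a\vdash_A\beta$ for all $\beta\in b$": (I1) if $a\in\mathrm{Con}_A$ and $a\vdash_A b$ ($b$ finite), then $a\cup b\in\mathrm{Con}_A$; (I2) if $\alpha\in a\in \mathrm{Con}_A$, then $a\vdash_A\alpha$; (I3) if $a\vdash_A b$ and $b\vdash_A\gamma$, then $a\vdash_A\gamma$; (I4) $\emptyset\vdash_A\nu_A$. A subset $x\subseteq A$ is finitely consistent if all its finite subsets are in $\mathrm{Con}_A$; for such $x$, $x\!\downarrow_A=\{\alpha\in A:\exists a\subseteq_{\mathrm f}x,\ a\vdash_A\alpha\}$. A point of $\mathcal{A}$ is a set of the form $x\!\downarrow_A$; $\mathcal{A}^+$ is the set of points ordered by inclusion (a Scott domain). The exponential $\mathcal{A}\Rightarrow\mathcal{B}$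 has token set $\mathrm{Con}_A\times B$, distinguished token $(\emptyset,\nu_B)$; $\{(a_1,\beta_1),\dots,(a_k,\beta_k)\}$ is consistent iff for all $I\subseteq\{1,\dots,k\}$, $\bigcup_{i\in I}a_i\in\mathrm{Con}_A$ implies $\{\beta_i:i\in I\}\in\mathrm{Con}_B$; and $\{(a_1,\beta_1),\dots,(a_k,\beta_k)\}\vdash(c,\gamma)$ iff $\{\beta_i: c\vdash_A a_i\}\vdash_B\gamma$. A b-morphism $f:\mathcal{A}\to\mathcal{B}$ is a function $f:A\to B$ such that (Mo) for every finite $a\subseteq A$: $a\in\mathrm{Con}_A$ iff $f(a)\in\mathrm{Con}_B$ (where $f(a)$ is the image of $a$); (bMo) if $a\in\mathrm{Con}_A$, $\alpha\in A$ and $f(a)\vdash_B f(\alpha)$, then $a\vdash_A\alpha$. An i-web is a pair $\mathbf{A}=(\mathcal{A},\phi)$ where $\mathcal{A}$ is an information system and $\phi:(\mathcal{A}\Rightarrow\mathcal{A})\to\mathcal{A}$ is a b-morphism. The associated i-model $\mathbf{A}^+$ is $\mathcal{A}^+$ with the following interpretation of $\lambda$-terms, for environments $\rho:\mathrm{Var}\to\mathcal{A}^+$: $[\![x]\!]_\rho=\rho(x)$; $[\![\lambda y.M]\!]_\rho=\{\phi(a,\alpha): a\in\mathrm{Con}_A,\ \alpha\in[\![M]\!]_{\rho[y:=a\downarrow_A]}\}\!\downarrow_A$; $[\![MN]\!]_\rho=[\![M]\!]_\rho\cdot[\![N]\!]_\rho$, where for points $u,z$, $u\cdot z=\{\beta\in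 A:\exists a\subseteq_{\mathrm f}z,\ (a,\beta)\in\{(a',\beta'):\phi(a',\beta')\in u\}\!\downarrow_{A\Rightarrow A}\}$. This is a model of the untyped $\lambda$-calculus (a $\lambda$-model, coming from a reflexive object in the category of Scott domains). An equation $M=N$ between closed $\lambda$-terms holds in $\mathbf{A}^+$ if $[\![M]\!]=[\![N]\!]$ in $\mathbf{A}^+$; $\mathrm{Eq}(\mathbf{A}^+)$ is the set of all such equations. -}

module Defs where

open import Data.Fin.Base using (Fin; zero; suc)
open import Data.List.Base using (List; []; _∷_; [_]; _++_; map; concatMap)
open import Data.List.Relation.Unary.All as All using (All; []; _∷_)
import Data.List.Relation.Unary.All.Properties as Allₚ
open import Data.List.Relation.Unary.Any as Any using (Any; here; there)
import Data.List.Relation.Unary.Any.Properties as Anyₚ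
import Data.List.Membership.Setoid as Membership
import Data.List.Membership.Setoid.Properties as Membershipₚ
import Data.List.Relation.Binary.Subset.Setoid as Subset
import Data.List.Relation.Binary.Subset.Setoid.Properties as Subsetₚ
open import Data.Nat.Base using (ℕ; suc)
open import Data.Product using (Σ; ∃; _×_; _,_; proj₁; proj₂)
open import Data.Sum.Base using (inj₁; inj₂)
open import Data.Vec.Functional using (Vector) renaming (_∷_ to _∷ᵛ_; [] to []ᵛ)
open import Function.Base using (_∘_)
open import Function.Bundles using (Func; _⇔_; module Equivalence)
open import Level using (Level) renaming (suc to lsuc)
open import Relation.Binary.Bundles using (Setoid)
open import Relation.Binary.Core using (REL; Rel)
open import Relation.Binary.PropositionalEquality.Core as ≡ using (_≡_)
open import Relation.Unary using (Pred; _≐_)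

private variable
  ℓ : Level
  n : ℕ

-- Sets are setoids; a finite subset is a list of tokens, two lists denoting
-- the same finite subset when each is contained in the other up to _≈_.
-- Since Con is closed under _⊆_, it depends only on the finite subset denoted;
-- by I2 and I3 the same is true of _⊢_, which also respects _≈_.

record InfoSys ℓ : Set (lsuc ℓ) where
  infix 4 _⊢_ _⊢*_
  field
    tokens : Setoid ℓ ℓ

  open Setoid tokens public renaming (Carrier to Token)
  open Membership tokens public using (_∈_)
  open Subset tokens public using (_⊆_)

  field
    ν   : Token
    Con : Pred (List Token) ℓ
    _⊢_ : REL (List Token) Token ℓ

  _⊢*_ : Rel (List Token) ℓ
  a ⊢* b = All (a ⊢_) b

  field
    Con-⊆         : ∀ {a b} → a ⊆ b → Con b → Con a
    Con-singleton : ∀ α → Con [ α ]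
    ⊢-Con         : ∀ {a α} → a ⊢ α → Con a
    I1            : ∀ {a b} → Con a → a ⊢* b → Con (a ++ b)
    I2            : ∀ {a α} → Con a → α ∈ a → a ⊢ α
    I3            : ∀ {a b γ} → Con a → a ⊢* b → b ⊢ γ → a ⊢ γ
    I4            : [] ⊢ ν

  FinCon : Pred (Pred Token ℓ) ℓ
  FinCon x = ∀ a → All x a → Con a

  infix 8 _↓
  _↓ : Pred Token ℓ → Pred Token ℓ
  (x ↓) α = ∃ λ a → All x a × a ⊢ α

  -- The generating set x need not respect _≈_: it has the same x ↓, and is
  -- finitely consistent under the same condition, as its closure under _≈_.
  IsPoint : Pred (Pred Token ℓ) (lsuc ℓ)
  IsPoint u = Σ (Pred Token ℓ) λ x → FinCon x × u ≐ x ↓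

  Point : Set (lsuc ℓ)
  Point = Σ (Pred Token ℓ) IsPoint

  FinConSet : Set ℓ
  FinConSet = Σ (List Token) Con

  FinCon-list : ((a , _) : FinConSet) → FinCon (_∈ a)
  FinCon-list (a , p) b b⊆a = Con-⊆ (All.lookupₛ tokens (λ y≈z y∈a →
    Membershipₚ.∈-resp-≈ tokens y≈z y∈a) b⊆a) p

  principal : FinConSet → Point
  principal A@(a , _) = (_∈ a) ↓ , (_∈ a) , FinCon-list A , (λ p → p) , (λ p → p)

  ⊢*-⊆ : ∀ {a b} → Con b → a ⊆ b → b ⊢* a
  ⊢*-⊆ p a⊆b = All.tabulateₛ tokens (λ α∈a → I2 p (a⊆b α∈a))

  ⊢-mono : ∀ {a b α} → Con b → a ⊆ b → a ⊢ α → b ⊢ α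
  ⊢-mono p a⊆b = I3 p (⊢*-⊆ p a⊆b)

  ⊢-resp-≈ : ∀ {a α β} → α ≈ β → a ⊢ α → a ⊢ β
  ⊢-resp-≈ α≈β a⊢α =
    I3 (⊢-Con a⊢α) (a⊢α ∷ []) (I2 (Con-singleton _) (here (sym α≈β)))

  ↓-support : ∀ {x} → FinCon x → ∀ {b} → All (x ↓) b →
              ∃ λ a → All x a × a ⊢* b
  ↓-support fx [] = [] , [] , []
  ↓-support fx ((a , xa , a⊢β) ∷ bs) with ↓-support fx bs
  ... | a′ , xa′ , a′⊢b =
    a ++ a′ , Allₚ.++⁺ xa xa′ ,
    ⊢-mono p (Subsetₚ.xs⊆xs++ys tokens a a′) a⊢β ∷
    All.map (⊢-mono p (Subsetₚ.xs⊆ys++xs tokens a′ a)) a′⊢b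
    where p = fx _ (Allₚ.++⁺ xa xa′)

  ↓-FinCon : ∀ {x} → FinCon x → FinCon (x ↓)
  ↓-FinCon fx b xb with ↓-support fx xb
  ... | a , xa , a⊢b =
    Con-⊆ (Subsetₚ.xs⊆ys++xs tokens b a) (I1 (fx a xa) a⊢b)

  ↓-closed : ∀ {x} → FinCon x → ∀ {b γ} → All (x ↓) b → b ⊢ γ → (x ↓) γ
  ↓-closed fx xb b⊢γ with ↓-support fx xb
  ... | a , xa , a⊢b = a , xa , I3 (fx a xa) a⊢b b⊢γ

  ↓-resp-≈ : ∀ {x α β} → α ≈ β → (x ↓) α → (x ↓) β
  ↓-resp-≈ α≈β (a , xa , a⊢α) = a , xa , ⊢-resp-≈ α≈β a⊢α

  ↓-mono : ∀ {x y} → (∀ {α} → x α → y α) → ∀ {α} → (x ↓) α → (y ↓) α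
  ↓-mono x⊆y (a , xa , a⊢α) = a , All.map x⊆y xa , a⊢α

  ↓-singleton : ∀ {x : Pred Token ℓ} {α} → x α → (x ↓) α
  ↓-singleton xα = _ , xα ∷ [] , I2 (Con-singleton _) (here refl)

  point-FinCon : ∀ {u} → IsPoint u → FinCon u
  point-FinCon (x , fx , u⊆x↓ , _) b ub = ↓-FinCon fx b (All.map u⊆x↓ ub)

  point-closed : ∀ {u} → IsPoint u → ∀ {b γ} → All u b → b ⊢ γ → u γ
  point-closed (x , fx , u⊆x↓ , x↓⊆u) ub b⊢γ =
    x↓⊆u (↓-closed fx (All.map u⊆x↓ ub) b⊢γ)

  point-resp-≈ : ∀ {u} → IsPoint u → ∀ {α β} → α ≈ β → u α → u β
  point-resp-≈ (x , fx , u⊆x↓ , x↓⊆u) α≈β uα = x↓⊆u (↓-resp-≈ α≈β (u⊆x↓ uα))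

  mkPoint : ∀ {u} → FinCon u → (∀ {b γ} → All u b → b ⊢ γ → u γ) → IsPoint u
  mkPoint {u} fu cl = u , fu , ↓-singleton , (λ (b , ub , b⊢γ) → cl ub b⊢γ)

module Exponential {ℓ} (𝓐 𝓑 : InfoSys ℓ) where
  private
    module A = InfoSys 𝓐
    module B = InfoSys 𝓑

  Tok : Set ℓ
  Tok = A.FinConSet × B.Token

  ante : Tok → List A.Token
  ante ((a , _) , _) = a

  antes : List Tok → List A.Token
  antes = concatMap ante

  conses : List Tok → List B.Token
  conses = map proj₂

  infix 4 _≈ₜ_
  record _≈ₜ_ (s t : Tok) : Set ℓ where
    constructor mk≈
    field
      ante-⊆  : ante s A.⊆ ante t
      ante-⊇  : ante t A.⊆ ante s
      conse-≈ : proj₂ s B.≈ proj₂ t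

  tokens : Setoid ℓ ℓ
  tokens = record
    { Carrier = Tok
    ; _≈_ = _≈ₜ_
    ; isEquivalence = record
      { refl  = mk≈ (λ m → m) (λ m → m) B.refl
      ; sym   = λ (mk≈ p q r) → mk≈ q p (B.sym r)
      ; trans = λ (mk≈ p q r) (mk≈ p′ q′ r′) →
          mk≈ (λ m → p′ (p m)) (λ m → q (q′ m)) (B.trans r r′)
      }
    }

  open Setoid tokens using (_≈_; refl)
  open Membership tokens using (_∈_)
  open Subset tokens using (_⊆_)

  Con : Pred (List Tok) ℓ
  Con X = ∀ I → I ⊆ X → A.Con (antes I) → B.Con (conses I)

  -- {βᵢ : c ⊢ aᵢ}
  fired : List Tok → List A.Token → Pred B.Token ℓ
  fired X c β = Any (λ ((a , _) , β′) → c A.⊢* a × β B.≈ β′) X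

  -- fired X c cannot be listed without deciding which aᵢ are entailed by c, so
  -- "fired X c entails γ" is expressed as γ ∈ (fired X c)↓; for a finite
  -- consistent set the two agree, by I2 and I3.
  infix 4 _⊢_
  _⊢_ : REL (List Tok) Tok ℓ
  X ⊢ ((c , _) , γ) = Con X × (fired X c B.↓) γ

  ∈-antes : ∀ {t X} → t ∈ X → ante t A.⊆ antes X
  ∈-antes (here (mk≈ p _ _)) m = Anyₚ.++⁺ˡ (p m)
  ∈-antes {X = s ∷ _} (there t∈X) m = Anyₚ.++⁺ʳ (ante s) (∈-antes t∈X m)

  fired-∈ : ∀ {X c t} → t ∈ X → A.Con c → ante t A.⊆ c → fired X c (proj₂ t)
  fired-∈ t∈X p a⊆c =
    Any.map (λ (mk≈ _ q r) → A.⊢*-⊆ p (λ m → a⊆c (q m)) , r) t∈X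

  ⊢-trans* : ∀ {a b c} → A.Con c → c A.⊢* b → b A.⊢* a → c A.⊢* a
  ⊢-trans* p c⊢b = All.map (A.I3 p c⊢b)

  fired-mono : ∀ {X b c β} → A.Con c → c A.⊢* b → fired X b β → fired X c β
  fired-mono p c⊢b = Any.map (λ (b⊢a , r) → ⊢-trans* p c⊢b b⊢a , r)

  fired-support : ∀ {X c b} → All (fired X c) b →
    ∃ λ I → I ⊆ X × c A.⊢* antes I × b B.⊆ conses I
  fired-support [] = [] , (λ ()) , [] , λ ()
  fired-support {X} {c} (f ∷ fs) with Membership.find tokens f | fired-support fs
  ... | t , t∈X , c⊢a , β≈ | I , I⊆X , c⊢I , b⊆I =
    t ∷ I ,
    (λ { (here p) → Membershipₚ.∈-resp-≈ tokens (Setoid.sym tokens p) t∈X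
       ; (there m) → I⊆X m }) ,
    Allₚ.++⁺ c⊢a c⊢I ,
    λ { (here p) → here (B.trans p β≈) ; (there m) → there (b⊆I m) }

  fired-FinCon : ∀ {X c} → Con X → A.Con c → B.FinCon (fired X c)
  fired-FinCon pX pc b fb with fired-support fb
  ... | I , I⊆X , c⊢I , b⊆I = B.Con-⊆ b⊆I
    (pX I I⊆X (A.Con-⊆ (Subsetₚ.xs⊆ys++xs A.tokens (antes I) _) (A.I1 pc c⊢I)))

  exp : InfoSys ℓ
  exp = record
    { tokens = tokens
    ; ν = ([] , A.⊢-Con A.I4) , B.ν
    ; Con = Con
    ; _⊢_ = _⊢_
    ; Con-⊆ = λ X⊆Y pY I I⊆X → pY I (λ m → X⊆Y (I⊆X m))
    ; Con-singleton = λ t I I⊆t _ → B.Con-⊆ (single I⊆t) (B.Con-singleton (proj₂ t))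
    ; ⊢-Con = proj₁
    ; I1 = I1′
    ; I2 = λ {_} {t} pX t∈X → pX , B.↓-singleton
        (fired-∈ t∈X (proj₂ (proj₁ t)) (λ m → m))
    ; I3 = λ {X} {Y} {t} pX X⊢Y (_ , b , Yb , b⊢γ) → pX ,
        B.↓-closed (fired-FinCon pX (proj₂ (proj₁ t)))
          (All.map (fired-trans pX (proj₂ (proj₁ t)) X⊢Y) Yb) b⊢γ
    ; I4 = (λ I I⊆[] _ → B.Con-⊆ (none I⊆[]) (B.⊢-Con B.I4)) , [] , [] , B.I4
    }
    where
    single : ∀ {t I} → I ⊆ [ t ] → conses I B.⊆ [ proj₂ t ]
    single {I = s ∷ I} I⊆t (here p) with I⊆t (here refl)
    ... | here (mk≈ _ _ q) = here (B.trans p q)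
    single {I = s ∷ I} I⊆t (there m) = single {I = I} (I⊆t ∘ there) m

    none : ∀ {I} → I ⊆ [] → conses I B.⊆ []
    none {s ∷ I} I⊆[] _ with I⊆[] (here refl)
    ... | ()

    fired-trans : ∀ {X Y c β} → Con X → A.Con c → All (X ⊢_) Y →
                  fired Y c β → (fired X c B.↓) β
    fired-trans pX pc ((_ , X↓) ∷ _) (here (c⊢b , β≈)) =
      B.↓-resp-≈ (B.sym β≈) (B.↓-mono (fired-mono pc c⊢b) X↓)
    fired-trans pX pc (_ ∷ X⊢Y) (there f) = fired-trans pX pc X⊢Y f

    I1′ : ∀ {X Y} → Con X → All (X ⊢_) Y → Con (X ++ Y)
    I1′ {X} {Y} pX X⊢Y I I⊆ pc =
      B.↓-FinCon (fired-FinCon pX pc) (conses I) (Allₚ.map⁺ (All.tabulateₛ tokens out))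
      where
      out : ∀ {t} → t ∈ I → (fired X (antes I) B.↓) (proj₂ t)
      out t∈I with Membershipₚ.∈-++⁻ tokens X (I⊆ t∈I)
      ... | inj₁ t∈X = B.↓-singleton (fired-∈ t∈X pc (∈-antes t∈I))
      ... | inj₂ t∈Y = fired-trans pX pc X⊢Y (fired-∈ t∈Y pc (∈-antes t∈I))

infixr 5 _⇒_
_⇒_ : InfoSys ℓ → InfoSys ℓ → InfoSys ℓ
𝓐 ⇒ 𝓑 = Exponential.exp 𝓐 𝓑

record BMorphism (𝓐 𝓑 : InfoSys ℓ) : Set ℓ where
  private
    module A = InfoSys 𝓐
    module B = InfoSys 𝓑
  field
    func : Func A.tokens B.tokens
  open Func func public
  field
    Mo  : ∀ a → A.Con a ⇔ B.Con (map to a)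
    bMo : ∀ {a α} → A.Con a → map to a B.⊢ to α → a A.⊢ α

record IWeb ℓ : Set (lsuc ℓ) where
  field
    infoSys : InfoSys ℓ
    φ       : BMorphism (infoSys ⇒ infoSys) infoSys

-- λ-terms modulo α-conversion: well-scoped de Bruijn terms, where zero is the
-- variable bound by the nearest ƛ.
infixl 7 _·_
data Term (n : ℕ) : Set where
  var : Fin n → Term n
  ƛ_  : Term (suc n) → Term n
  _·_ : Term n → Term n → Term n

ClosedTerm : Set
ClosedTerm = Term 0

module Interpretation {ℓ} (𝐀 : IWeb ℓ) where
  open IWeb 𝐀
  open InfoSys infoSys
  private
    module E = InfoSys (infoSys ⇒ infoSys)
    module Exp = Exponential infoSys infoSys
    module φ = BMorphism φ

  Env : ℕ → Set (lsuc ℓ)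
  Env = Vector Point

  abstraction : Pred E.Token ℓ → Pred Token ℓ
  abstraction F = (λ τ → ∃ λ t → F t × τ ≈ φ.to t) ↓

  application : Pred Token ℓ → Pred Token ℓ → Pred Token ℓ
  application u z β =
    Σ FinConSet λ A → All z (proj₁ A) × ((λ t → u (φ.to t)) E.↓) (A , β)

  ⟦_⟧ : Term n → Env n → Pred Token ℓ
  ⟦ var i ⟧ ρ = proj₁ (ρ i)
  ⟦ ƛ M ⟧ ρ = abstraction (λ (a , α) → ⟦ M ⟧ (principal a ∷ᵛ ρ) α)
  ⟦ M · N ⟧ ρ = application (⟦ M ⟧ ρ) (⟦ N ⟧ ρ)

  abstraction-isPoint : ∀ {F : Pred E.Token ℓ} →
    (∀ {a} (p : Con a) → IsPoint (λ α → F ((a , p) , α))) →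
    (∀ {a b α} (p : Con a) (q : Con b) → a ⊆ b → F ((a , p) , α) → F ((b , q) , α)) →
    IsPoint (abstraction F)
  abstraction-isPoint {F} pt mono =
    _ , fin , (λ p → p) , (λ p → p)
    where
    gather : ∀ {b} → All (λ τ → ∃ λ t → F t × τ ≈ φ.to t) b →
             ∃ λ X → All F X × b ⊆ map φ.to X
    gather [] = [] , [] , λ ()
    gather ((t , Ft , τ≈) ∷ xs) with gather xs
    ... | X , FX , b⊆ = t ∷ X , Ft ∷ FX ,
      λ { (here p) → here (trans p τ≈) ; (there m) → there (b⊆ m) }

    F-resp : ∀ {s t} → s E.≈ t → F s → F t
    F-resp {(_ , p) , _} {(_ , q) , _} (Exp.mk≈ a⊆b _ α≈β) Fs =
      point-resp-≈ (pt q) α≈β (mono p q a⊆b Fs)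

    con : ∀ {X} → All F X → E.Con X
    con {X} FX I I⊆X pc = point-FinCon (pt pc) _
      (Allₚ.map⁺ (All.tabulateₛ E.tokens λ {t} t∈I →
        mono (proj₂ (proj₁ t)) pc (Exp.∈-antes t∈I)
             (All.lookupₛ E.tokens F-resp FX (I⊆X t∈I))))

    fin : FinCon (λ τ → ∃ λ t → F t × τ ≈ φ.to t)
    fin b xb with gather xb
    ... | X , FX , b⊆ = Con-⊆ b⊆ (Equivalence.to (φ.Mo X) (con FX))

  application-isPoint : ∀ {u z} → IsPoint u → IsPoint z → IsPoint (application u z)
  application-isPoint {u} {z} pu pz = mkPoint fin closed
    where
    v : Pred E.Token ℓ
    v t = u (φ.to t)

    v-FinCon : E.FinCon v
    v-FinCon X vX =
      Equivalence.from (φ.Mo X) (point-FinCon pu (map φ.to X) (Allₚ.map⁺ vX))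

    gather : ∀ {b} → All (application u z) b →
             ∃ λ X → All (v E.↓) X × All z (Exp.antes X) × Exp.conses X ≡ b
    gather [] = [] , [] , [] , ≡.refl
    gather ((A , zA , vAβ) ∷ xs) with gather xs
    ... | X , vX , zX , ≡.refl = (A , _) ∷ X , vAβ ∷ vX , Allₚ.++⁺ zA zX , ≡.refl

    fin : FinCon (application u z)
    fin b ub with gather ub
    ... | X , vX , zX , ≡.refl =
      E.↓-FinCon v-FinCon X vX X (λ m → m) (point-FinCon pz _ zX)

    closed : ∀ {b γ} → All (application u z) b → b ⊢ γ → application u z γ
    closed {γ = γ} ub b⊢γ with gather ub
    ... | X , vX , zX , ≡.refl =
      (Exp.antes X , pc) , zX ,
      E.↓-closed {x = v} v-FinCon {b = X} {γ = (_ , pc) , γ} vX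
        (E.↓-FinCon v-FinCon X vX , Exp.conses X ,
        Allₚ.map⁺ (All.tabulateₛ E.tokens λ t∈X →
          Exp.fired-∈ t∈X pc (Exp.∈-antes t∈X)) , b⊢γ)
      where pc = point-FinCon pz _ zX

  ⟦⟧-mono : ∀ (M : Term n) {ρ σ : Env n} →
    (∀ i {α} → proj₁ (ρ i) α → proj₁ (σ i) α) → ∀ {α} → ⟦ M ⟧ ρ α → ⟦ M ⟧ σ α
  ⟦⟧-mono (var i) ρ⊆σ = ρ⊆σ i
  ⟦⟧-mono (ƛ M) ρ⊆σ = ↓-mono (λ ((A , α) , Mα , τ≈) → (A , α) ,
    ⟦⟧-mono M (λ { zero p → p ; (suc i) p → ρ⊆σ i p }) Mα , τ≈)
  ⟦⟧-mono (M · N) {ρ} {σ} ρ⊆σ {α} (A , NA , vAβ) =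
    A , All.map (⟦⟧-mono N ρ⊆σ) NA ,
    E.↓-mono {x = ⟦ M ⟧ ρ ∘ φ.to} {y = ⟦ M ⟧ σ ∘ φ.to}
      (⟦⟧-mono M ρ⊆σ) {A , α} vAβ

  ⟦⟧-isPoint : ∀ (M : Term n) (ρ : Env n) → IsPoint (⟦ M ⟧ ρ)
  ⟦⟧-isPoint (var i) ρ = proj₂ (ρ i)
  ⟦⟧-isPoint (ƛ M) ρ = abstraction-isPoint
    (λ p → ⟦⟧-isPoint M (principal (_ , p) ∷ᵛ ρ))
    (λ p q a⊆b → ⟦⟧-mono M λ
      { zero → ↓-mono a⊆b ; (suc i) r → r })
  ⟦⟧-isPoint (M · N) ρ = application-isPoint (⟦⟧-isPoint M ρ) (⟦⟧-isPoint N ρ)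

infix 4 _⊨_≃_
_⊨_≃_ : IWeb ℓ → ClosedTerm → ClosedTerm → Set ℓ
𝐀 ⊨ M ≃ N = ⟦ M ⟧ []ᵛ ≐ ⟦ N ⟧ []ᵛ
  where open Interpretation 𝐀

{-# OPTIONS --safe #-}
module Submission where

-- Choose, for each equation that fails in some i-model, an i-web 𝐀 j refuting
-- it.  A single i-web 𝐁 refutes all of them.  Its tokens are finite subsets c
-- of the 𝐀 j (base j c) and arrows a ↦ β, with φ (a , β) = a ↦ β; every set of
-- tokens is consistent.  The value of a closed term M in 𝐁 determines its value
-- u in 𝐀 j, since it contains base j c whenever c ⊆ u, and only then:
-- containment goes by induction on M, and for the converse a logical relation
-- U τ d, "τ is bounded above by the point d of 𝐀 j", is defined by recursion on
-- tokens and shown to hold between all τ in the value of M in 𝐁 and d = u.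

open import Defs
open import Axiom.ExcludedMiddle using (ExcludedMiddle)
open import Data.Empty using (⊥; ⊥-elim)
open import Data.Fin.Base using (Fin)
open import Data.Fin.Properties using (_≟_)
open import Data.List.Base using (List; []; _∷_; [_]; _++_; map; filter)
open import Data.List.Membership.Propositional using () renaming (_∈_ to _∈ₚ_; find to findₚ)
open import Data.List.Membership.Propositional.Properties using (∈-filter⁺)
import Data.List.Membership.Setoid as Membership
open import Data.List.Properties using (++-identityʳ)
open import Data.List.Relation.Binary.Sublist.Propositional
  using (from∈; []; _∷_; _∷ʳ_) renaming (_⊆_ to _⊑_)
open import Data.List.Relation.Binary.Sublist.Propositional.Properties
  using (filter-⊆; All-resp-⊆; Any-resp-⊆)
import Data.List.Relation.Binary.Subset.Setoid.Properties as Subsetₚ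
open import Data.List.Relation.Unary.All as All using (All; []; _∷_)
import Data.List.Relation.Unary.All.Properties as Allₚ
open import Data.List.Relation.Unary.Any as Any using (Any; here; there)
import Data.List.Relation.Unary.Any.Properties as Anyₚ
open import Data.Nat.Base using (ℕ)
open import Data.Product using (Σ; ∃; _×_; _,_; proj₁; proj₂)
open import Data.Unit.Polymorphic.Base using (⊤; tt)
open import Data.Vec.Functional using () renaming (_∷_ to _∷ᵛ_; [] to []ᵛ)
open import Function.Base using (_∘_; id)
open import Function.Bundles using (_⇔_; mk⇔; module Equivalence)
open import Level using (Lift; lift; lower; suc)
open import Relation.Binary.Bundles using (Setoid)
open import Relation.Binary.PropositionalEquality.Core using (_≡_; refl; subst)
open import Relation.Nullary using (¬_; Dec; yes; no; contradiction)
open import Relation.Nullary.Decidable using (map′; True; toWitness; fromWitness; decidable-stable)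
open import Relation.Unary using (Pred)

-- Sublists selected by excluded middle.

module _ {ℓ} (em : ExcludedMiddle ℓ) (𝓐 𝓑 : InfoSys ℓ) where
  private
    module A = InfoSys 𝓐
    module B = InfoSys 𝓑
  open Exponential 𝓐 𝓑

  -- Each entailment hides its own list of fired consequents. Excluded middle decides which
  -- antecedents `A` entails, so filtering `T` gives one `I` that serves all of `b`.
  fired-sublist : ∀ {T A b} → Con T → All (λ β → T ⊢ (A , β)) b →
    ∃ λ I → I ⊑ T × A.Con (antes I) × proj₁ A A.⊢* antes I × conses I B.⊢* b
  fired-sublist {T} {A@(a , pa)} {b} pT T⊢ = I , I⊑T , pI , a⊢I , All.map conse T⊢
    where
    P? : ∀ t → Dec (a A.⊢* ante t)
    P? t = em

    I : List Tok
    I = filter P? T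

    I⊑T : I ⊑ T
    I⊑T = filter-⊆ P? T

    a⊢I : a A.⊢* antes I
    a⊢I = Allₚ.concat⁺ (Allₚ.map⁺ (Allₚ.all-filter P? T))

    pI : A.Con (antes I)
    pI = A.Con-⊆ (Subsetₚ.xs⊆ys++xs A.tokens (antes I) a) (A.I1 pa a⊢I)

    pcI : B.Con (conses I)
    pcI = pT I (Any-resp-⊆ I⊑T) pI

    listed : ∀ {β} → fired T a β → β B.∈ conses I
    listed f with findₚ f
    ... | t , t∈T , a⊢ , β≈ =
      Anyₚ.map⁺ (Any.map (λ { refl → β≈ }) (∈-filter⁺ P? t∈T a⊢))

    conse : ∀ {β} → T ⊢ (A , β) → conses I B.⊢ β
    conse (_ , l , fl , l⊢β) =
      B.I3 pcI (All.map (B.I2 pcI ∘ listed) fl) l⊢β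

-- `fold` has a premise for each consistent sublist, while membership in `x ↓` rests on one finite
-- list. There are finitely many sublists, and excluded middle decides `C` at each.
sublist-cover : ∀ {ℓ} → ExcludedMiddle ℓ → {X Y : Set ℓ} {x : Pred Y ℓ}
  (C : Pred (List X) ℓ) (f : List X → Y) (T : List X) →
  (∀ {I} → I ⊑ T → C I → x (f I)) →
  ∃ λ Γ → All x Γ × (∀ {I} → I ⊑ T → C I → f I ∈ₚ Γ)
sublist-cover em C f [] xf with em {C []}
... | yes p = [ f [] ] , xf [] p ∷ [] , λ { [] _ → here refl }
... | no ¬p = [] , [] , λ { [] p → contradiction p ¬p }
sublist-cover em C f (t ∷ T) xf
  with sublist-cover em C f T (λ I⊑T → xf (t ∷ʳ I⊑T))
     | sublist-cover em (C ∘ (t ∷_)) (f ∘ (t ∷_)) T (λ I⊑T → xf (refl ∷ I⊑T))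
... | Γ , xΓ , c | Δ , xΔ , d = Γ ++ Δ , Allₚ.++⁺ xΓ xΔ , λ
  { (_ ∷ʳ I⊑T) p → Anyₚ.++⁺ˡ (c I⊑T p)
  ; (refl ∷ I⊑T) p → Anyₚ.++⁺ʳ Γ (d I⊑T p) }

-- Continuity and finite support of the interpretation.

module IWebProperties {ℓ} (𝐀 : IWeb ℓ) where
  open IWeb 𝐀
  open InfoSys infoSys hiding (refl)
  open Interpretation 𝐀
  private
    module E = InfoSys (infoSys ⇒ infoSys)
    module φ = BMorphism φ
    module Ex = Exponential infoSys infoSys

  infix 4 _≤ₑ_
  _≤ₑ_ : ∀ {n} → Env n → Env n → Set ℓ
  ρ ≤ₑ σ = ∀ i {α} → proj₁ (ρ i) α → proj₁ (σ i) α

  record Approx {n} (ρ : Env n) : Set ℓ where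
    constructor approx
    field
      set    : Fin n → FinConSet
      within : ∀ i → All (proj₁ (ρ i)) (proj₁ (set i))

    env : Env n
    env i = principal (set i)

    env-≤ : env ≤ₑ ρ
    env-≤ i {α} (b , b⊆ , b⊢α) = point-closed (proj₂ (ρ i)) {b} {α}
      (All.map (All.lookupₛ tokens (point-resp-≈ (proj₂ (ρ i))) (within i)) b⊆) b⊢α

  open Approx using (env; env-≤)

  module _ {n} {ρ : Env n} where

    least : Approx ρ
    least = approx (λ _ → [] , ⊢-Con I4) (λ _ → [])

    join : Approx ρ → Approx ρ → Approx ρ
    join (approx s s∈) (approx t t∈) = approx
      (λ i → proj₁ (s i) ++ proj₁ (t i) , point-FinCon (proj₂ (ρ i)) _ (Allₚ.++⁺ (s∈ i) (t∈ i)))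
      (λ i → Allₚ.++⁺ (s∈ i) (t∈ i))

    join-≤ˡ : ∀ S T → env S ≤ₑ env (join S T)
    join-≤ˡ S T i = ↓-mono {_∈ proj₁ (Approx.set S i)} {_∈ proj₁ (Approx.set (join S T) i)}
      (Subsetₚ.xs⊆xs++ys tokens _ _)

    join-≤ʳ : ∀ S T → env T ≤ₑ env (join S T)
    join-≤ʳ S T i = ↓-mono {_∈ proj₁ (Approx.set T i)} {_∈ proj₁ (Approx.set (join S T) i)}
      (Subsetₚ.xs⊆ys++xs tokens _ _)

    collect : ∀ {x} {X : Set x} (F : Env n → Pred X ℓ) →
      (∀ {σ τ} → σ ≤ₑ τ → ∀ {t} → F σ t → F τ t) →
      (∀ {t} → F ρ t → Σ (Approx ρ) λ S → F (env S) t) →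
      ∀ {c} → All (F ρ) c → Σ (Approx ρ) λ S → All (F (env S)) c
    collect F mono f [] = least , []
    collect F mono f (p ∷ ps) with f p | collect F mono f ps
    ... | S , q | T , qs =
      join S T , mono {env S} {env (join S T)} (join-≤ˡ S T) q ∷
      All.map (mono {env T} {env (join S T)} (join-≤ʳ S T)) qs

    at : ∀ i {α} → proj₁ (ρ i) α → Σ (Approx ρ) λ S → proj₁ (env S i) α
    at i {α} ρα = approx (proj₁ ∘ single) (proj₂ ∘ single) , single-∈
      where
      single : ∀ k → Σ FinConSet λ A → All (proj₁ (ρ k)) (proj₁ A)
      single k with i ≟ k
      ... | yes refl = ([ α ] , Con-singleton α) , ρα ∷ []
      ... | no _ = ([] , ⊢-Con I4) , []

      single-∈ : proj₁ (principal (proj₁ (single i))) α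
      single-∈ with i ≟ i
      ... | yes refl = ↓-singleton {_∈ [ α ]} (here (Setoid.refl tokens))
      ... | no i≢i = contradiction refl i≢i

  ƛ-gen : ∀ {n} → Term (ℕ.suc n) → Env n → Pred Token ℓ
  ƛ-gen M ρ τ = ∃ λ t → ⟦ M ⟧ (principal (proj₁ t) ∷ᵛ ρ) (proj₂ t) × τ ≈ φ.to t

  ƛ-gen-mono : ∀ {n} (M : Term (ℕ.suc n)) {ρ σ} → ρ ≤ₑ σ → ∀ {τ} → ƛ-gen M ρ τ → ƛ-gen M σ τ
  ƛ-gen-mono M {ρ} {σ} ρ≤σ (t , p , τ≈) =
    t , ⟦⟧-mono M {principal (proj₁ t) ∷ᵛ ρ} {principal (proj₁ t) ∷ᵛ σ}
      (λ { Fin.zero → id ; (Fin.suc i) → ρ≤σ i }) p , τ≈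

  -- A derivation uses finitely many tokens of the environment. Under `ƛ`, the approximation of the
  -- bound variable is dropped again, as it lies below the `principal` already in place.
  continuous : ∀ {n} (M : Term n) {ρ α} → ⟦ M ⟧ ρ α → Σ (Approx ρ) λ S → ⟦ M ⟧ (env S) α
  continuous (var i) p = at i p
  continuous (ƛ M) {ρ} (b , gb , b⊢α) = proj₁ r , b , proj₂ r , b⊢α
    where
    gen : ∀ {τ} → ƛ-gen M ρ τ → Σ (Approx ρ) λ S → ƛ-gen M (env S) τ
    gen (t , p , τ≈) with continuous M p
    ... | S@(approx s s∈) , q = S′ , t ,
      ⟦⟧-mono M {env S} {principal (proj₁ t) ∷ᵛ env S′}
        (λ { Fin.zero → env-≤ S Fin.zero ; (Fin.suc i) → id }) q , τ≈
      where
      S′ : Approx ρ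
      S′ = approx (s ∘ Fin.suc) (s∈ ∘ Fin.suc)

    r : Σ (Approx ρ) λ S → All (ƛ-gen M (env S)) b
    r = collect (ƛ-gen M) (ƛ-gen-mono M) gen gb
  continuous (M · N) {ρ} (A , Na , X , MX , X⊢)
    with collect ⟦ N ⟧ (⟦⟧-mono N) (continuous N) Na
       | collect (λ σ t → ⟦ M ⟧ σ (φ.to t)) (λ σ≤τ → ⟦⟧-mono M σ≤τ) (continuous M) MX
  ... | S , Na′ | T , MX′ = join S T , A ,
    All.map (⟦⟧-mono N {env S} {env (join S T)} (join-≤ˡ S T)) Na′ ,
    X , All.map (⟦⟧-mono M {env T} {env (join S T)} (join-≤ʳ S T)) MX′ , X⊢

  -- The union of the antecedents used for the members of `c` is consistent, since it lies in `z`,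
  -- and entails each of them, so it can replace them all. The supporting lists merge into `T`.
  application-support : ∀ {u z} → IsPoint u → IsPoint z → ∀ {c} → All (application u z) c →
    Σ FinConSet λ A → All z (proj₁ A) ×
    ∃ λ T → E.Con T × All (u ∘ φ.to) T × All (λ β → T E.⊢ (A , β)) c
  application-support {u} {z} pu pz uc with gather uc
    where
    gather : ∀ {c} → All (application u z) c →
      ∃ λ X → All ((u ∘ φ.to) E.↓) X × All z (Ex.antes X) × Ex.conses X ≡ c
    gather [] = [] , [] , [] , refl
    gather ((A , zA , uA) ∷ us) with gather us
    ... | X , uX , zX , refl = (A , _) ∷ X , uA ∷ uX , Allₚ.++⁺ zA zX , refl
  ... | X , uX , zX , refl with E.↓-support v-FinCon uX
    where
    v-FinCon : E.FinCon (u ∘ φ.to)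
    v-FinCon T uT = Equivalence.from (φ.Mo T) (point-FinCon pu (map φ.to T) (Allₚ.map⁺ uT))
  ... | T , uT , T⊢X = A , zX , T , pT , uT ,
    Allₚ.map⁺ (All.tabulateₛ E.tokens λ {t} t∈X →
      E.I3 {γ = A , proj₂ t} pT T⊢X
        (pX , ↓-singleton {Ex.fired X (Ex.antes X)} (Ex.fired-∈ t∈X (proj₂ A) (Ex.∈-antes t∈X))))
    where
    A : FinConSet
    A = Ex.antes X , point-FinCon pz _ zX

    pT : E.Con T
    pT = Equivalence.from (φ.Mo T) (point-FinCon pu (map φ.to T) (Allₚ.map⁺ uT))

    pX : E.Con X
    pX = E.Con-⊆ (Subsetₚ.xs⊆ys++xs E.tokens X T) (E.I1 pT T⊢X)

  ƛ-gen-FinCon : ∀ {n} (M : Term (ℕ.suc n)) ρ → FinCon (ƛ-gen M ρ)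
  ƛ-gen-FinCon M ρ = proj₁ (proj₂ (⟦⟧-isPoint (ƛ M) ρ))

  ƛ-gen-support : ∀ {n} (M : Term (ℕ.suc n)) {ρ b} → All (ƛ-gen M ρ) b → ∃ λ T →
    All (λ t → ⟦ M ⟧ (principal (proj₁ t) ∷ᵛ ρ) (proj₂ t)) T × b ⊆ map φ.to T
  ƛ-gen-support M [] = [] , [] , λ ()
  ƛ-gen-support M ((t , p , τ≈) ∷ gs) with ƛ-gen-support M gs
  ... | T , MT , b⊆ = t ∷ T , p ∷ MT , λ
    { (here e) → here (Setoid.trans tokens e τ≈) ; (there m) → there (b⊆ m) }

  ƛ-support : ∀ {n} (M : Term (ℕ.suc n)) {ρ c} → All (⟦ ƛ M ⟧ ρ) c →
    ∃ λ T → E.Con T × All (λ t → ⟦ M ⟧ (principal (proj₁ t) ∷ᵛ ρ) (proj₂ t)) T × map φ.to T ⊢* c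
  ƛ-support M {ρ} {c} Mc = generated (↓-support {ƛ-gen M ρ} (ƛ-gen-FinCon M ρ) Mc)
    where
    generated : (∃ λ b → All (ƛ-gen M ρ) b × b ⊢* c) →
      ∃ λ T → E.Con T × All (λ t → ⟦ M ⟧ (principal (proj₁ t) ∷ᵛ ρ) (proj₂ t)) T × map φ.to T ⊢* c
    generated (b , gb , b⊢c) with ƛ-gen-support M gb
    ... | T , MT , b⊆ = T , Equivalence.from (φ.Mo T) pφT , MT , All.map (⊢-mono pφT b⊆) b⊢c
      where
      pφT : Con (map φ.to T)
      pφT = ƛ-gen-FinCon M ρ _ (Allₚ.map⁺ (All.map (λ {t} p → t , p , Setoid.refl tokens) MT))

  -- One inclusion of the β-law, from continuity: the finite part of `d` on which `β` depends is the
  -- antecedent `A`.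
  β-expansion : ∀ {n} (M : Term (ℕ.suc n)) {ρ : Env n} (d : Point) {β} →
    ⟦ M ⟧ (d ∷ᵛ ρ) β → application (⟦ ƛ M ⟧ ρ) (proj₁ d) β
  β-expansion M {ρ} d {β} p with continuous M p
  ... | S , q = A , Approx.within S Fin.zero ,
    E.↓-singleton {⟦ ƛ M ⟧ ρ ∘ φ.to} (↓-singleton {ƛ-gen M ρ}
      ((A , β) , ⟦⟧-mono M {env S} {principal A ∷ᵛ ρ}
        (λ { Fin.zero → id ; (Fin.suc i) → env-≤ S (Fin.suc i) }) q , Setoid.refl tokens))
    where
    A : FinConSet
    A = Approx.set S Fin.zero

-- The information system amalgamating a family of i-webs.

module WeakProduct {ℓ} (em : ExcludedMiddle ℓ) {J : Set ℓ} (𝐀 : J → IWeb ℓ) where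
  private
    module A (j : J) = InfoSys (IWeb.infoSys (𝐀 j))
    module E (j : J) = InfoSys (IWeb.infoSys (𝐀 j) ⇒ IWeb.infoSys (𝐀 j))
    module Ex (j : J) = Exponential (IWeb.infoSys (𝐀 j)) (IWeb.infoSys (𝐀 j))
    module φ (j : J) = BMorphism (IWeb.φ (𝐀 j))

  -- base j c and base j d do not entail base j (c ++ d): the union c ++ d can be
  -- inconsistent, and the joins that are present must be respected by arrows.
  infixr 5 _↦_
  data Tok : Set ℓ where
    ν    : Tok
    base : ∀ j → List (A.Token j) → Tok
    _↦_  : List Tok → Tok → Tok

  infix 4 _≈_
  data _≈_ : Tok → Tok → Set ℓ where
    ≈-refl  : ∀ {α} → α ≈ α
    ≈-sym   : ∀ {α β} → α ≈ β → β ≈ α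
    ≈-trans : ∀ {α β γ} → α ≈ β → β ≈ γ → α ≈ γ
    ↦-cong  : ∀ {a b α β} → All (λ x → Any (x ≈_) b) a → All (λ y → Any (y ≈_) a) b →
              α ≈ β → a ↦ α ≈ b ↦ β

  -- The conclusion is an equivalence because `≈-sym` swaps the sides; the premises of `↦-cong` are
  -- symmetric, so a one-way `step` yields both directions.
  ≈-invariant : ∀ {p} (P : Pred Tok p) →
    (∀ {a b α β} → All (λ x → Any (x ≈_) b) a → All (λ y → Any (y ≈_) a) b →
      α ≈ β → P (a ↦ α) → P (b ↦ β)) →
    ∀ {τ σ} → τ ≈ σ → P τ ⇔ P σ
  ≈-invariant P step ≈-refl = mk⇔ id id
  ≈-invariant P step (≈-sym e) with ≈-invariant P step e
  ... | r = mk⇔ (Equivalence.from r) (Equivalence.to r)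
  ≈-invariant P step (≈-trans e f) with ≈-invariant P step e | ≈-invariant P step f
  ... | r | s = mk⇔ (Equivalence.to s ∘ Equivalence.to r) (Equivalence.from r ∘ Equivalence.from s)
  ≈-invariant P step (↦-cong p q e) = mk⇔ (step p q e) (step q p (≈-sym e))

  tokens : Setoid ℓ ℓ
  tokens = record
    { Carrier = Tok ; _≈_ = _≈_
    ; isEquivalence = record { refl = ≈-refl ; sym = ≈-sym ; trans = ≈-trans } }

  open Membership tokens using (_∈_)

  -- In unfold, the token ν marks the antecedent.  Being entailed by everything, it
  -- is invisible to application, but it prevents fold from using the arrows that
  -- unfold produces.  Otherwise base j (φ T) would entail base j (φ T′) whenever
  -- T ⊢ T′, whereas φ need not preserve entailment.
  infix 4 _⊢_ _⊢*_
  data _⊢_ (Γ : List Tok) : Tok → Set ℓ where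
    ∈⇒⊢    : ∀ {τ} → τ ∈ Γ → Γ ⊢ τ
    ≈-resp : ∀ {τ σ} → τ ≈ σ → Γ ⊢ τ → Γ ⊢ σ
    ⊢ν     : Γ ⊢ ν
    weaken : ∀ {j c d} → A.Con j c → A._⊢*_ j c d → Γ ⊢ base j c → Γ ⊢ base j d
    fold   : ∀ {j T} → E.Con j T →
             (∀ {I} → I ⊑ T → A.Con j (Ex.antes j I) →
               Γ ⊢ [ base j (Ex.antes j I) ] ↦ base j (Ex.conses j I)) →
             Γ ⊢ base j (map (φ.to j) T)
    unfold : ∀ {j T b} A → E.Con j T → All (λ β → E._⊢_ j T (A , β)) b →
             Γ ⊢ base j (map (φ.to j) T) → Γ ⊢ (ν ∷ [ base j (proj₁ A) ]) ↦ base j b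

  _⊢*_ : List Tok → List Tok → Set ℓ
  Γ ⊢* Δ = All (Γ ⊢_) Δ

  cut : ∀ {Γ Δ τ} → Γ ⊢* Δ → Δ ⊢ τ → Γ ⊢ τ
  cut Γ⊢Δ (∈⇒⊢ τ∈Δ) = All.lookupₛ tokens ≈-resp Γ⊢Δ τ∈Δ
  cut Γ⊢Δ (≈-resp e d) = ≈-resp e (cut Γ⊢Δ d)
  cut Γ⊢Δ ⊢ν = ⊢ν
  cut Γ⊢Δ (weaken p c⊢d d) = weaken p c⊢d (cut Γ⊢Δ d)
  cut Γ⊢Δ (fold p f) = fold p (λ I⊑T q → cut Γ⊢Δ (f I⊑T q))
  cut Γ⊢Δ (unfold A p q d) = unfold A p q (cut Γ⊢Δ d)

  𝓑 : InfoSys ℓ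
  𝓑 = record
    { tokens = tokens
    ; ν = ν
    ; Con = λ _ → ⊤
    ; _⊢_ = _⊢_
    ; Con-⊆ = λ _ _ → tt
    ; Con-singleton = λ _ → tt
    ; ⊢-Con = λ _ → tt
    ; I1 = λ _ _ → tt
    ; I2 = λ _ → ∈⇒⊢
    ; I3 = λ _ → cut
    ; I4 = ⊢ν
    }

  private
    module B = InfoSys 𝓑
    module E𝓑 = InfoSys (𝓑 ⇒ 𝓑)
    open Exponential 𝓑 𝓑 using (fired; mk≈)

  -- The arrow map is a b-morphism.

  to : E𝓑.Token → Tok
  to ((a , _) , β) = a ↦ β

  -- An invariant of the tokens derivable from arrows X; at arrows it is the
  -- condition bMo.
  Fired : List E𝓑.Token → Pred Tok ℓ
  Fired X ν = ⊤
  Fired X (base j c) = ∃ λ T → E.Con j T × A._⊢*_ j (map (φ.to j) T) c ×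
    (∀ {I} → I ⊑ T → A.Con j (Ex.antes j I) →
      (fired X [ base j (Ex.antes j I) ] B.↓) (base j (Ex.conses j I)))
  Fired X (a ↦ β) = (fired X a B.↓) β

  fired-⊢* : ∀ {X a b β} → b ⊢* a → (fired X a B.↓) β → (fired X b B.↓) β
  fired-⊢* {X} {a} {b} b⊢a =
    B.↓-mono {x = fired X a} {y = fired X b} (Exponential.fired-mono 𝓑 𝓑 tt b⊢a)

  ↓-cut : ∀ {x : Pred Tok ℓ} {Γ τ} → All (x B.↓) Γ → Γ ⊢ τ → (x B.↓) τ
  ↓-cut {x} = B.↓-closed {x = x} (λ _ _ → tt)

  ⊆⇒⊢* : ∀ {a b} → All (λ x → Any (x ≈_) b) a → b ⊢* a
  ⊆⇒⊢* = All.map ∈⇒⊢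

  Fired-≈ : ∀ X {τ σ} → τ ≈ σ → Fired X τ → Fired X σ
  Fired-≈ X e = Equivalence.to (≈-invariant (Fired X)
    (λ {a} a⊆b _ α≈β f → B.↓-resp-≈ {x = fired X _} α≈β (fired-⊢* {X} {a} (⊆⇒⊢* a⊆b) f)) e)

  Fired-∈ : ∀ {X τ} → τ ∈ map to X → Fired X τ
  Fired-∈ {X} τ∈ with findₚ (Anyₚ.map⁻ τ∈)
  ... | ((a , _) , β) , t∈X , τ≈ = Fired-≈ X (≈-sym τ≈)
    (B.↓-singleton {x = fired X a}
      (Any.map (λ { refl → All.tabulateₛ tokens ∈⇒⊢ , ≈-refl }) t∈X))

  -- Induction on the derivation. `X` contributes only arrows, so a base token stems from a `fold`,
  -- whose `T` and premises `Fired` keeps for a later `unfold`.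
  Fired-sound : ∀ {X τ} → map to X ⊢ τ → Fired X τ
  Fired-sound (∈⇒⊢ τ∈) = Fired-∈ τ∈
  Fired-sound {X} (≈-resp e d) = Fired-≈ X e (Fired-sound d)
  Fired-sound ⊢ν = tt
  Fired-sound (weaken {j} p c⊢d d) with Fired-sound d
  ... | T , pT , T⊢c , f = T , pT , All.map (A.I3 j (Equivalence.to (φ.Mo j T) pT) T⊢c) c⊢d , f
  Fired-sound (fold {j} {T} pT f) =
    T , pT , A.⊢*-⊆ j (Equivalence.to (φ.Mo j T) pT) id , λ I⊑T q → Fired-sound (f I⊑T q)
  Fired-sound {X} (unfold {j} {S} {b} (a , pa) pS S⊢ d) with Fired-sound d
  -- `bMo` of `φ j` turns entailment between the images into entailment of `S` by `T`, hence of
  -- `(A , β)` for every `β` in `b`.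
  ... | T , pT , T⊢S , f with fired-sublist em (IWeb.infoSys (𝐀 j)) (IWeb.infoSys (𝐀 j)) {T} {a , pa} {b} pT
          (All.map (λ {β} → E.I3 j {γ = (a , pa) , β} pT (All.map (φ.bMo j pT) (Allₚ.map⁻ T⊢S))) S⊢)
  ... | I , I⊑T , pI , a⊢I , I⊢b =
    -- The premise of `fold` for `I` as a whole enters here: base tokens obtained from its members
    -- separately need not combine.
    ↓-cut {x = fired X (ν ∷ [ base j a ])} {[ base j (Ex.conses j I) ]}
      (fired-⊢* {X} {[ base j (Ex.antes j I) ]}
        (weaken pa a⊢I (∈⇒⊢ (there (here ≈-refl))) ∷ []) (f I⊑T pI) ∷ [])
      (weaken (pT I (Any-resp-⊆ I⊑T) pI) I⊢b (∈⇒⊢ (here ≈-refl)))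

  𝐁 : IWeb ℓ
  𝐁 = record
    { infoSys = 𝓑
    ; φ = record
      { func = record
        { to = to
        ; cong = λ (mk≈ a⊆b b⊆a e) →
            ↦-cong (All.tabulateₛ tokens a⊆b) (All.tabulateₛ tokens b⊆a) e
        }
      ; Mo = λ X → mk⇔ (λ _ → tt) (λ _ _ _ _ → tt)
      ; bMo = λ p d → p , Fired-sound d
      }
    }

  private module I𝐁 = Interpretation 𝐁

  -- From values in `𝐀 j` to base tokens in `𝐁`.

  module _ (j : J) where
    open Interpretation (𝐀 j)
    open IWebProperties (𝐀 j)
    open InfoSys (IWeb.infoSys (𝐀 j)) using (Point; FinConSet; principal)

    infix 4 _≼_
    _≼_ : ∀ {n} → Env n → I𝐁.Env n → Set ℓ
    ρ ≼ σ = ∀ i {c} → All (proj₁ (ρ i)) c → proj₁ (σ i) (base j c)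

    principal-≼ : ∀ (A : FinConSet) {c} → All (proj₁ (principal A)) c →
      proj₁ (B.principal ([ base j (proj₁ A) ] , tt)) (base j c)
    principal-≼ (a , p) a⊢c = [ base j a ] , here ≈-refl ∷ [] ,
      weaken p (All.map below a⊢c) (∈⇒⊢ (here ≈-refl))
      where
      below : ∀ {α} → proj₁ (principal (a , p)) α → A._⊢_ j a α
      below (l , l⊆ , l⊢α) = A.I3 j p (All.map (A.I2 j p) l⊆) l⊢α

    arrow : List (E.Token j) → Tok
    arrow I = [ base j (Ex.antes j I) ] ↦ base j (Ex.conses j I)

    graph-antes : ∀ {n} (M : Term (ℕ.suc n)) {ρ : Env n} {I} (pI : A.Con j (Ex.antes j I)) →
      All (λ t → ⟦ M ⟧ (principal (proj₁ t) ∷ᵛ ρ) (proj₂ t)) I →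
      All (⟦ M ⟧ (principal (Ex.antes j I , pI) ∷ᵛ ρ)) (Ex.conses j I)
    graph-antes M {ρ} {I} pI MI = Allₚ.map⁺ (All.tabulate λ {t} t∈I →
      ⟦⟧-mono M {principal (proj₁ t) ∷ᵛ ρ} {principal (Ex.antes j I , pI) ∷ᵛ ρ}
        (λ { Fin.zero → A.↓-mono j {λ α → A._∈_ j α (Ex.ante j t)} {λ α → A._∈_ j α (Ex.antes j I)}
               (Ex.∈-antes j (Any.map (λ { refl → Setoid.refl (E.tokens j) }) t∈I))
           ; (Fin.suc i) → id })
        (All.lookup MI t∈I))

    ƛ-lower : ∀ {n} (M : Term (ℕ.suc n)) {σ : I𝐁.Env n} {T c} → E.Con j T →
      A._⊢*_ j (map (φ.to j) T) c →
      (∀ {I} → I ⊑ T → A.Con j (Ex.antes j I) → IWebProperties.ƛ-gen 𝐁 M σ (arrow I)) →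
      I𝐁.⟦ ƛ M ⟧ σ (base j c)
    ƛ-lower M {T = T} pT T⊢c gen with sublist-cover em (A.Con j ∘ Ex.antes j) arrow T gen
    ... | Γ , gΓ , ∈Γ = Γ , gΓ , weaken (Equivalence.to (φ.Mo j T) pT) T⊢c
      (fold pT λ I⊑T pI → ∈⇒⊢ (Any.map (λ { refl → ≈-refl }) (∈Γ I⊑T pI)))

    ·-lower : ∀ {n} (M N : Term n) {σ : I𝐁.Env n} {T c} (A : FinConSet) → E.Con j T →
      All (λ β → E._⊢_ j T (A , β)) c →
      I𝐁.⟦ M ⟧ σ (base j (map (φ.to j) T)) → I𝐁.⟦ N ⟧ σ (base j (proj₁ A)) →
      I𝐁.⟦ M · N ⟧ σ (base j c)
    ·-lower M N {σ} {T} {c} A@(a , _) pT T⊢ MT Na =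
      (ν ∷ [ base j a ] , tt) ,
      -- The marker costs nothing: every point contains `ν`.
      B.point-closed (I𝐁.⟦⟧-isPoint N σ) {[]} {ν} [] ⊢ν ∷ Na ∷ [] ,
      E𝓑.↓-singleton {I𝐁.⟦ M ⟧ σ ∘ to} (B.point-closed (I𝐁.⟦⟧-isPoint M σ)
        {[ base j (map (φ.to j) T) ]} {(ν ∷ [ base j a ]) ↦ base j c}
        (MT ∷ []) (unfold A pT T⊢ (∈⇒⊢ (here ≈-refl))))

    -- The induction treats whole finite sets `c`, as `base j c` need not follow from the tokens of
    -- its parts. At `ƛ`, the body at `Ex.antes j I` gives an arrow for each consistent `I ⊑ T`, and
    -- `fold` combines these.
    lower-bound : ∀ {n} (M : Term n) {ρ : Env n} {σ : I𝐁.Env n} → ρ ≼ σ →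
      ∀ {c} → All (⟦ M ⟧ ρ) c → I𝐁.⟦ M ⟧ σ (base j c)
    lower-bound (var i) ρ≼σ = ρ≼σ i
    lower-bound (ƛ M) {ρ} {σ} ρ≼σ {c} Mc =
      let T , pT , MT , T⊢c = ƛ-support M Mc in
      ƛ-lower M pT T⊢c λ {I} I⊑T pI →
        (([ base j (Ex.antes j I) ] , tt) , base j (Ex.conses j I)) ,
        lower-bound M {principal (Ex.antes j I , pI) ∷ᵛ ρ} {B.principal _ ∷ᵛ σ}
          (λ { Fin.zero → principal-≼ (Ex.antes j I , pI) ; (Fin.suc i) → ρ≼σ i })
          (graph-antes M pI (All-resp-⊆ I⊑T MT)) , ≈-refl
    lower-bound (M · N) {ρ} ρ≼σ MNc =
      let A , Na , T , pT , MT , T⊢ = application-support (⟦⟧-isPoint M ρ) (⟦⟧-isPoint N ρ) MNc in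
      ·-lower M N A pT T⊢ (lower-bound M ρ≼σ (Allₚ.map⁺ MT)) (lower-bound N ρ≼σ Na)

    -- The logical relation and the way back to `𝐀 j`.

    app : Point → Point → Point
    app (u , pu) (z , pz) = application u z , application-isPoint pu pz

    app-mono : ∀ {u v} z → (∀ {α} → proj₁ u α → proj₁ v α) →
      ∀ {α} → proj₁ (app u z) α → proj₁ (app v z) α
    app-mono {u} {v} z u⊆v {α} (A , zA , uA) =
      A , zA , E.↓-mono j {proj₁ u ∘ φ.to j} {proj₁ v ∘ φ.to j} u⊆v {A , α} uA

    -- Fold is sound for U because of this condition; the functional part of U at
    -- arrows would not suffice, as d may lack φ (a , β) although β ∈ d · a ↓.
    Graph : List Tok → Tok → Pred Point ℓ
    Graph a β d = ∀ a′ b′ (p : A.Con j a′) → (a ↦ β) ≈ ([ base j a′ ] ↦ base j b′) →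
      All (λ γ → proj₁ d (φ.to j ((a′ , p) , γ))) b′

    -- The base clause assumes an equation, so tokens of other components hold of every point. `U*`
    -- stands for `All` to keep the recursion structural.
    U  : Tok → Pred Point (suc ℓ)
    U* : List Tok → Pred Point (suc ℓ)
    U ν d = ⊤
    U (base k c) d = (e : k ≡ j) → Lift (suc ℓ) (All (proj₁ d) (subst (List ∘ A.Token) e c))
    U (a ↦ β) d = Lift (suc ℓ) (Graph a β d) × (∀ z → U* a z → U β (app d z))
    U* [] d = ⊤
    U* (α ∷ a) d = U α d × U* a d

    U*⁺ : ∀ {a d} → All (λ α → U α d) a → U* a d
    U*⁺ [] = tt
    U*⁺ (u ∷ us) = u , U*⁺ us

    U*⁻ : ∀ {a d} → U* a d → All (λ α → U α d) a
    U*⁻ {[]} _ = []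
    U*⁻ {_ ∷ _} (u , us) = u ∷ U*⁻ us

    U-mono : ∀ τ {d e} → (∀ {α} → proj₁ d α → proj₁ e α) → U τ d → U τ e
    U-mono ν d⊆e _ = tt
    U-mono (base k c) d⊆e u eq = lift (All.map d⊆e (lower (u eq)))
    U-mono (a ↦ β) {d} {e} d⊆e (lift g , f) =
      lift (λ a′ b′ p eq → All.map d⊆e (g a′ b′ p eq)) ,
      λ z uz → U-mono β (λ {α} → app-mono {d} {e} z d⊆e {α}) (f z uz)

    -- `Graph` ranges over a whole `≈`-class and so transfers by transitivity; the functional half
    -- uses `U*-resp` contravariantly.
    U-resp   : ∀ {τ σ} → τ ≈ σ → ∀ {d} → U τ d ⇔ U σ d
    U*-resp  : ∀ {a b} → All (λ x → Any (x ≈_) b) a → ∀ {d} → U* b d → U* a d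
    U*-resp₁ : ∀ {x b} → Any (x ≈_) b → ∀ {d} → U* b d → U x d
    U-resp ≈-refl = mk⇔ id id
    U-resp (≈-sym e) = mk⇔ (Equivalence.from (U-resp e)) (Equivalence.to (U-resp e))
    U-resp (≈-trans e f) = mk⇔ (Equivalence.to (U-resp f) ∘ Equivalence.to (U-resp e))
      (Equivalence.from (U-resp e) ∘ Equivalence.from (U-resp f))
    U-resp (↦-cong p q e) = mk⇔
      (λ (lift g , f) → lift (λ a′ b′ r eq → g a′ b′ r (≈-trans (↦-cong p q e) eq)) ,
        λ z uz → Equivalence.to (U-resp e) (f z (U*-resp p uz)))
      (λ (lift g , f) → lift (λ a′ b′ r eq → g a′ b′ r (≈-trans (≈-sym (↦-cong p q e)) eq)) ,
        λ z uz → Equivalence.from (U-resp e) (f z (U*-resp q uz)))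
    U*-resp [] _ = tt
    U*-resp (p ∷ ps) u = U*-resp₁ p u , U*-resp ps u
    U*-resp₁ (here e) (u , _) = Equivalence.from (U-resp e) u
    U*-resp₁ (there m) (_ , us) = U*-resp₁ m us

    IsBase : Pred Tok ℓ
    IsBase ν = Lift ℓ ⊥
    IsBase (base _ _) = ⊤
    IsBase (_ ↦ _) = Lift ℓ ⊥

    -- Separates the marked antecedents of unfold from the unmarked ones.
    AllBase : Pred Tok ℓ
    AllBase ν = ⊤
    AllBase (base _ _) = ⊤
    AllBase (a ↦ _) = All IsBase a

    IsBase-≈ : ∀ {τ σ} → τ ≈ σ → IsBase τ → IsBase σ
    IsBase-≈ = Equivalence.to ∘ ≈-invariant IsBase (λ _ _ _ ())

    AllBase-≈ : ∀ {τ σ} → τ ≈ σ → AllBase τ → AllBase σ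
    AllBase-≈ = Equivalence.to ∘ ≈-invariant AllBase
      (λ _ b⊆a _ as → All.map (λ y∈a → All.lookupₛ tokens IsBase-≈ as y∈a) b⊆a)

    -- The halves of `U` at arrows serve different rules: `fold` reads tokens of `d` off `Graph`,
    -- while `unfold` proves the functional half, its marked antecedent making `Graph` vacuous.
    U-sound : ∀ {Γ τ} → Γ ⊢ τ → ∀ {d} → U* Γ d → U τ d
    U-sound (∈⇒⊢ τ∈Γ) u = U*-resp₁ τ∈Γ u
    U-sound (≈-resp e d) u = Equivalence.to (U-resp e) (U-sound d u)
    U-sound ⊢ν u = tt
    U-sound (weaken p c⊢d d) {x} u refl =
      lift (All.map (A.point-closed j (proj₂ x) (lower (U-sound d u refl))) c⊢d)
    U-sound (fold {T = T} pT f) {d} u refl = lift (Allₚ.map⁺ (All.tabulate graph))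
      where
      graph : ∀ {t} → t ∈ₚ T → proj₁ d (φ.to j t)
      graph {t@((a , p) , β)} t∈T =
        -- The arrow used is that of the sublist `[ t ]`. Its antecedent is the list `a ++ []`, so
        -- the token found is only equivalent to `φ.to j t`.
        A.point-resp-≈ j (proj₂ d) (φ.cong j (Exponential.mk≈ a⁺⊆a a⊆a⁺ (Setoid.refl (A.tokens j))))
          (All.head (lower (proj₁ (U-sound (f (from∈ t∈T) p⁺) u)) (Ex.antes j [ t ]) [ β ] p⁺ ≈-refl))
        where
        a⁺⊆a : A._⊆_ j (Ex.antes j [ t ]) a
        a⁺⊆a {x} = subst (Any (A._≈_ j x)) (++-identityʳ a)

        a⊆a⁺ : A._⊆_ j a (Ex.antes j [ t ])
        a⊆a⁺ = Anyₚ.++⁺ˡ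

        p⁺ : A.Con j (Ex.antes j [ t ])
        p⁺ = A.Con-⊆ j a⁺⊆a p
    U-sound (unfold {k} {T} (a , p) pT T⊢ d) {x} u =
      -- An equivalent arrow with antecedent `[ base j a′ ]` would make `ν` a base token.
      lift (λ _ _ _ e → ⊥-elim (lower (All.head (AllBase-≈ (≈-sym e) (tt ∷ []))))) ,
      λ { z (_ , uz , _) refl → lift (All.map
            (λ {β} T⊢β → (a , p) , lower (uz refl) ,
              T , Allₚ.map⁻ (lower (U-sound d u refl)) , T⊢β) T⊢) }

    infix 4 _≽_
    _≽_ : ∀ {n} → Env n → I𝐁.Env n → Set (suc ℓ)
    ρ ≽ σ = ∀ i {τ} → proj₁ (σ i) τ → U τ (ρ i)

    U-↓ : ∀ {x d} → (∀ {τ} → x τ → U τ d) → ∀ {τ} → (x B.↓) τ → U τ d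
    U-↓ x⊆ (Γ , xΓ , Γ⊢τ) = U-sound Γ⊢τ (U*⁺ (All.map x⊆ xΓ))

    int : ∀ {n} → Term n → Env n → Point
    int M ρ = ⟦ M ⟧ ρ , ⟦⟧-isPoint M ρ

    ·-upper : ∀ {u z d e} → (∀ {τ} → u τ → U τ d) → (∀ {τ} → z τ → U τ e) →
      ∀ {τ} → I𝐁.application u z τ → U τ (app d e)
    ·-upper {u} {z} {d} {e} u≤d z≤e ((a , _) , za , X , uX , _ , l , fl , l⊢τ) =
      U-sound l⊢τ (U*⁺ (All.map (λ f → fires uX f) fl))
      where
      fires : ∀ {X β} → All (u ∘ to) X → fired X a β → U β (app d e)
      fires (uX ∷ _) (here (a⊢b , β≈)) = Equivalence.from (U-resp β≈)
        (proj₂ (u≤d uX) e (U*⁺ (All.map (λ a⊢y → U-sound a⊢y (U*⁺ (All.map z≤e za))) a⊢b)))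
      fires (_ ∷ uX) (there f) = fires uX f

    -- Extended trivially from arrows to all tokens so that `≈-invariant` applies.
    Body : ∀ {n} → Term (ℕ.suc n) → I𝐁.Env n → Pred Tok ℓ
    Body M σ ν = ⊤
    Body M σ (base _ _) = ⊤
    Body M σ (a ↦ β) = I𝐁.⟦ M ⟧ (B.principal (a , tt) ∷ᵛ σ) β

    Body-≈ : ∀ {n} (M : Term (ℕ.suc n)) (σ : I𝐁.Env n) {τ υ} → τ ≈ υ → Body M σ τ → Body M σ υ
    Body-≈ M σ = Equivalence.to ∘ ≈-invariant (Body M σ) λ {a} {b} a⊆b _ α≈β Mα →
      B.point-resp-≈ (I𝐁.⟦⟧-isPoint M (B.principal (b , tt) ∷ᵛ σ)) α≈β
        (I𝐁.⟦⟧-mono M {B.principal (a , tt) ∷ᵛ σ} {B.principal (b , tt) ∷ᵛ σ}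
          (λ { Fin.zero → B.↓-mono {_∈ a} {_∈ b} (λ x∈a → All.lookupₛ tokens
                 (λ x≈y → Any.map (≈-trans (≈-sym x≈y))) a⊆b x∈a)
             ; (Fin.suc i) → id }) Mα)

    -- Induction on `M`. At `ƛ`, the hypothesis for the body gives both halves of `U`: at any `z`,
    -- through `β-expansion`, the functional one; at principal points, `Graph`.
    upper-bound : ∀ {n} (M : Term n) {ρ : Env n} {σ : I𝐁.Env n} → ρ ≽ σ →
      ∀ {τ} → I𝐁.⟦ M ⟧ σ τ → U τ (int M ρ)
    upper-bound (var i) ρ≽σ = ρ≽σ i
    upper-bound (ƛ M) {ρ} {σ} ρ≽σ = U-↓ λ (((a , _) , β) , Mβ , τ≈) →
      Equivalence.from (U-resp τ≈) (lift (graph Mβ) , functional Mβ)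
      where
      body : ∀ {a β} → Body M σ (a ↦ β) → ∀ z → U* a z → U β (int M (z ∷ᵛ ρ))
      body {a} Mβ z uz = upper-bound M {z ∷ᵛ ρ} {B.principal (a , tt) ∷ᵛ σ}
        (λ { Fin.zero → U-↓ (λ τ∈a → U*-resp₁ τ∈a uz) ; (Fin.suc i) → ρ≽σ i }) Mβ

      functional : ∀ {a β} → Body M σ (a ↦ β) → ∀ z → U* a z → U β (app (int (ƛ M) ρ) z)
      functional {β = β} Mβ z uz = U-mono β (β-expansion M z) (body Mβ z uz)

      graph : ∀ {a β} → Body M σ (a ↦ β) → Graph a β (int (ƛ M) ρ)
      graph Mβ a′ b′ p e = All.map
        (λ {γ} Mγ → A.↓-singleton j {ƛ-gen M ρ} (((a′ , p) , γ) , Mγ , Setoid.refl (A.tokens j)))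
        -- `Body-≈` passes to the equivalent arrow from `base j a′`, which `principal (a′ , p)`
        -- bounds.
        (lower (body (Body-≈ M σ e Mβ) (principal (a′ , p))
          ((λ { refl → lift (All.tabulateₛ (A.tokens j)
              (A.↓-singleton j {λ α → A._∈_ j α a′})) }) , tt) refl))
    upper-bound (M · N) {σ = σ} ρ≽σ =
      ·-upper (upper-bound M {σ = σ} ρ≽σ) (upper-bound N {σ = σ} ρ≽σ)

    -- `α` travels through `𝐁` as `base j [ α ]`: `lower-bound` puts it in the value of `M`,
    -- `upper-bound` brings it back from that of `N`.
    reflects-⊆ : ∀ {M N} → (∀ {τ} → I𝐁.⟦ M ⟧ []ᵛ τ → I𝐁.⟦ N ⟧ []ᵛ τ) →
      ∀ {α} → ⟦ M ⟧ []ᵛ α → ⟦ N ⟧ []ᵛ α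
    reflects-⊆ {M} {N} M⊆N Mα = All.head (lower
      (upper-bound N {[]ᵛ} {[]ᵛ} (λ ()) (M⊆N (lower-bound M {[]ᵛ} {[]ᵛ} (λ ()) (Mα ∷ []))) refl))

  reflects-≃ : ∀ {M N} → 𝐁 ⊨ M ≃ N → ∀ j → 𝐀 j ⊨ M ≃ N
  reflects-≃ {M} {N} (M⊆N , N⊆M) j = reflects-⊆ j {M} {N} M⊆N , reflects-⊆ j {N} {M} N⊆M

mainTheorem7 : ∀ {ℓ} → ExcludedMiddle (suc ℓ) →
    Σ (IWeb ℓ) λ 𝐁 → ∀ (M N : ClosedTerm) →
    (𝐁 ⊨ M ≃ N) ⇔ (∀ (𝐀 : IWeb ℓ) → 𝐀 ⊨ M ≃ N)
mainTheorem7 {ℓ} em = 𝐁 , λ M N → mk⇔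
  -- If `𝐀` refuted the equation, the pair would be an index. Its chosen i-web, possibly other than
  -- `𝐀`, would then both refute the equation and satisfy it by `reflects-≃`.
  (λ B⊨ 𝐀 → decidable-stable emₗ λ 𝐀⊭ →
    proj₂ (toWitness {a? = refutation? M N} (fromWitness (𝐀 , 𝐀⊭)))
      (reflects-≃ {M} {N} B⊨ (lift ((M , N) , fromWitness (𝐀 , 𝐀⊭)))))
  (λ ⊨ → ⊨ 𝐁)
  where
  emₗ : ExcludedMiddle ℓ
  emₗ {P} = map′ lower lift (em {Lift (suc ℓ) P})

  refutation? : ∀ M N → Dec (Σ (IWeb ℓ) λ 𝐀 → ¬ (𝐀 ⊨ M ≃ N))
  refutation? M N = em

  -- `True` is a small type, so the index set fits in `Set ℓ` although i-webs live one universe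
  -- higher; `toWitness` then makes the choice.
  Refutable : Set ℓ
  Refutable = Lift ℓ (Σ (ClosedTerm × ClosedTerm) λ (M , N) → True (refutation? M N))

  refuter : Refutable → IWeb ℓ
  refuter (lift ((M , N) , r)) = proj₁ (toWitness r)

  open WeakProduct emₗ refuter
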